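{- Let $\Lambda$ be a linear order. There is a $\Lambda$-effective procedure which decides, for any closed formula $\phi$ (built from $\top$ using $\neg,\wedge$ and modalities $[\alpha]$ with $\alpha\in|\Lambda|$), whether $\mathsf{GLP}^0_\Lambda\vdash\phi$.
   Context: $\mathsf{GLP}_\Lambda$ (for a linear order $\Lambda$) is the modal logic in the language with modalities $[\alpha]$, $\alpha\in|\Lambda|$, $\langle\alpha\rangle:=\neg[\alpha]\neg$, axiomatized by propositional tautologies and, for all $\alpha,\beta\in|\Lambda|$: (i) $[\alpha](\chi\to\psi)\to([\alpha]\chi\to[\alpha]\psi)$; (ii) $[\alpha]([\alpha]\chi\to\chi)\to[\alpha]\chi$; (iii) $[\alpha]\chi\to[\beta][\alpha]\chi$ for $\alpha\le\beta$; (iv) $\langle\alpha\rangle\chi\to[\beta]\langle\alpha\rangle\chi$ for $\alpha<\beta$; (v) $[\alpha]\chi\to[\beta]\chi$ for $\alpha\le\beta$; with rules modus ponens and necessitation for each $[\alpha]$. A closed formula is one without propositional variables; $\mathsf{GLP}^0_\Lambda$ is the set of closed formulas provable in $\mathsf{GLP}_\Lambda$. A procedure is $\Lambda$-effective if it is effective using an oracle deciding $\alpha<\beta$ for $\alpha,\beta\in|\Lambda|$. -}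

module Defs where

open import Data.Nat using (ℕ)
open import Data.Bool using (Bool; true; false; not; _∧_)
open import Data.Sum using (_⊎_)
open import Relation.Binary.PropositionalEquality using (_≡_)

data Fm (A : Set) : Set where
  var  : ℕ → Fm A
  ⊤'   : Fm A
  ¬'_  : Fm A → Fm A
  _∧'_ : Fm A → Fm A → Fm A
  [_]_ : A → Fm A → Fm A

infixr 6 _∧'_
infix 7 ¬'_
infix 7 [_]_

module _ {A : Set} where
  infixr 5 _⇒_
  infix 7 ⟨_⟩_
  _⇒_ : Fm A → Fm A → Fm A
  φ ⇒ ψ = ¬' (φ ∧' ¬' ψ)

  ⟨_⟩_ : A → Fm A → Fm A
  ⟨ α ⟩ φ = ¬' ([ α ] ¬' φ)

  eval : (Fm A → Bool) → Fm A → Bool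
  eval ρ (var n)   = ρ (var n)
  eval ρ ⊤'        = true
  eval ρ (¬' φ)    = not (eval ρ φ)
  eval ρ (φ ∧' ψ)  = eval ρ φ ∧ eval ρ ψ
  eval ρ ([ α ] φ) = ρ ([ α ] φ)

  Tautology : Fm A → Set
  Tautology φ = (ρ : Fm A → Bool) → eval ρ φ ≡ true

data CFm (A : Set) : Set where
  ⊤c   : CFm A
  ¬c_  : CFm A → CFm A
  _∧c_ : CFm A → CFm A → CFm A
  [_]c_ : A → CFm A → CFm A

embed : {A : Set} → CFm A → Fm A
embed ⊤c         = ⊤'
embed (¬c φ)     = ¬' embed φ
embed (φ ∧c ψ)   = embed φ ∧' embed ψ
embed ([ α ]c φ) = [ α ] embed φ

module GLP {A : Set} (_<_ : A → A → Set) where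

  _≤_ : A → A → Set
  α ≤ β = (α < β) ⊎ (α ≡ β)

  data ⊢_ : Fm A → Set where
    taut : ∀ {φ} → Tautology φ → ⊢ φ
    axK  : ∀ {α χ ψ} → ⊢ ([ α ] (χ ⇒ ψ) ⇒ ([ α ] χ ⇒ [ α ] ψ))
    axL  : ∀ {α χ} → ⊢ ([ α ] ([ α ] χ ⇒ χ) ⇒ [ α ] χ)
    ax3  : ∀ {α β χ} → α ≤ β → ⊢ ([ α ] χ ⇒ [ β ] [ α ] χ)
    ax4  : ∀ {α β χ} → α < β → ⊢ (⟨ α ⟩ χ ⇒ [ β ] ⟨ α ⟩ χ)
    ax5  : ∀ {α β χ} → α ≤ β → ⊢ ([ α ] χ ⇒ [ β ] χ)
    mp   : ∀ {φ ψ} → ⊢ (φ ⇒ ψ) → ⊢ φ → ⊢ ψ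
    nec  : ∀ {α φ} → ⊢ φ → ⊢ ([ α ] φ)

  GLP⁰⊢_ : CFm A → Set
  GLP⁰⊢ φ = ⊢ embed φ

{-# OPTIONS --safe #-}
module Submission where

-- Every closed formula is provably equivalent to a Boolean combination of formulas ⟨γ⟩A
-- with A a worm over modalities ≥ γ. To eliminate ⟨γ⟩ it suffices to know that worms A, B
-- over modalities ≥ γ satisfy ⊢ A → B or ⊢ A ∧ B → ⟨γ⟩A: by Löb's axiom, ⟨γ⟩(A ∧ ¬B₁ ∧ …) is
-- then refutable or equivalent to ⟨γ⟩A. For γ the least modality of φ this either refutes ¬φ or
-- yields a worm A with ⊢ ⟨γ⟩A → ⟨γ⟩¬φ; in the latter case φ is unprovable because worms are
-- consistent. Their consistency is shown in Ignatiev's model: sequences of ordinals below ε₀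
-- in which each coordinate is at most the last exponent of the preceding one. As ⊥ is all that
-- is wanted from it, its semantics is read through double negations.

open import Defs
open import Relation.Nullary using (Dec)
open import Relation.Binary.Structures using (IsStrictTotalOrder)
open import Relation.Binary.PropositionalEquality using (_≡_)
open import Relation.Binary.PropositionalEquality using (refl; sym; trans; cong; cong₂; subst)
open import Relation.Binary.Definitions using (DecidableEquality; tri<; tri≈; tri>)
open import Relation.Nullary using (yes; no; ¬_; Reflects; ofʸ; invert; ¬-reflects; _×-reflects_; _×-dec_)
open import Relation.Nullary.Decidable using (map′; ¬¬-excluded-middle)
open import Relation.Nullary.Negation using (negated-stable; ¬¬-map)
open import Data.Bool using (Bool; true; false; T; not; _∧_; if_then_else_)
open import Data.Bool.Properties using (T-∧; T-≡)
open import Data.Empty using (⊥; ⊥-elim)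
open import Data.List using (List; []; _∷_; _++_; length; map)
open import Data.List.Membership.Propositional using (_∈_)
open import Data.List.Membership.Propositional.Properties using (∈-++⁺ˡ; ∈-++⁺ʳ)
open import Data.List.Relation.Unary.All as All using (All; []; _∷_)
open import Data.List.Relation.Unary.All.Properties using (++⁻ˡ; ++⁻ʳ)
open import Data.List.Relation.Unary.AllPairs using (AllPairs; []; _∷_)
open import Data.List.Relation.Unary.Any using (here; there)
open import Data.Nat as ℕ using (ℕ; zero; suc; pred; z≤n; s≤s)
import Data.Nat.Properties as ℕ
open import Data.Product using (Σ; ∃; _×_; _,_; proj₁; proj₂)
open import Data.Product.Function.NonDependent.Propositional using (_×-⇔_)
open import Data.Sum using (_⊎_; inj₁; inj₂)
open import Data.Unit using (⊤; tt)
open import Data.Vec using (Vec; []; _∷_)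
open import Function using (_∘_; id; _⇔_; mk⇔; Equivalence)
open import Function.Construct.Identity using (⇔-id)
open import Function.Construct.Symmetry using (⇔-sym)
open import Function.Construct.Composition using (_⇔-∘_)
open import Function.Related.TypeIsomorphisms using (¬-cong-⇔)
open import Induction.WellFounded using (Acc; acc)

-- Ordinals below ε₀

data Ord : Set where
  𝟎     : Ord
  ω^_+_ : Ord → Ord → Ord

infixr 8 ω^_+_
infix 4 _≺_ _⪯_ _◃_

data _≺_ : Ord → Ord → Set where
  𝟎≺   : ∀ {a d} → 𝟎 ≺ ω^ a + d
  exp≺ : ∀ {a b d e} → a ≺ b → ω^ a + d ≺ ω^ b + e
  rem≺ : ∀ {a d e} → d ≺ e → ω^ a + d ≺ ω^ a + e

_⪯_ : Ord → Ord → Set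
x ⪯ y = x ≺ y ⊎ x ≡ y

≺-trans : ∀ {x y z} → x ≺ y → y ≺ z → x ≺ z
≺-trans 𝟎≺       (exp≺ _) = 𝟎≺
≺-trans 𝟎≺       (rem≺ _) = 𝟎≺
≺-trans (exp≺ p) (exp≺ q) = exp≺ (≺-trans p q)
≺-trans (exp≺ p) (rem≺ q) = exp≺ p
≺-trans (rem≺ p) (exp≺ q) = exp≺ q
≺-trans (rem≺ p) (rem≺ q) = rem≺ (≺-trans p q)

≺-irrefl : ∀ {x} → ¬ (x ≺ x)
≺-irrefl (exp≺ p) = ≺-irrefl p
≺-irrefl (rem≺ p) = ≺-irrefl p

⪯-≺-trans : ∀ {x y z} → x ⪯ y → y ≺ z → x ≺ z
⪯-≺-trans (inj₁ p)    q = ≺-trans p q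
⪯-≺-trans (inj₂ refl) q = q

≺-⪯-trans : ∀ {x y z} → x ≺ y → y ⪯ z → x ≺ z
≺-⪯-trans p (inj₁ q)    = ≺-trans p q
≺-⪯-trans p (inj₂ refl) = p

⪯-trans : ∀ {x y z} → x ⪯ y → y ⪯ z → x ⪯ z
⪯-trans (inj₁ p)    q = inj₁ (≺-⪯-trans p q)
⪯-trans (inj₂ refl) q = q

≺-or-⪰ : ∀ x y → x ≺ y ⊎ y ⪯ x
≺-or-⪰ 𝟎 𝟎 = inj₂ (inj₂ refl)
≺-or-⪰ 𝟎 (ω^ _ + _) = inj₁ 𝟎≺
≺-or-⪰ (ω^ _ + _) 𝟎 = inj₂ (inj₁ 𝟎≺)
≺-or-⪰ (ω^ a + d) (ω^ b + e) with ≺-or-⪰ a b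
... | inj₁ p        = inj₁ (exp≺ p)
... | inj₂ (inj₁ p) = inj₂ (inj₁ (exp≺ p))
... | inj₂ (inj₂ refl) with ≺-or-⪰ d e
...   | inj₁ p           = inj₁ (rem≺ p)
...   | inj₂ (inj₁ p)    = inj₂ (inj₁ (rem≺ p))
...   | inj₂ (inj₂ refl) = inj₂ (inj₂ refl)

HeadBound : Ord → Ord → Set
HeadBound 𝟎          a = ⊤
HeadBound (ω^ b + _) a = b ⪯ a

CNF : Ord → Set
CNF 𝟎          = ⊤
CNF (ω^ a + d) = CNF a × HeadBound d a × CNF d

-- On raw terms `_≺_` descends forever, as in ω^1 > 1 + ω^1 > 1 + 1 + ω^1 > ...; normality of the
-- smaller term excludes this.
_≺ᶜ_ : Ord → Ord → Set
x ≺ᶜ y = CNF x × x ≺ y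

HeadBound⇒≺ : ∀ e {a b d} → HeadBound e b → b ≺ a → e ≺ ω^ a + d
HeadBound⇒≺ 𝟎          _ _ = 𝟎≺
HeadBound⇒≺ (ω^ _ + _) h p = exp≺ (⪯-≺-trans h p)

mutual
  -- Induction on the accessibility of the exponent, then on that of the remainder. Terms with a
  -- smaller leading exponent go to `smaller-acc`, which recurses on the term: by normality all its
  -- exponents stay below `a`.
  ω^-acc : ∀ {a d} → Acc _≺ᶜ_ a → Acc _≺ᶜ_ d → Acc _≺ᶜ_ (ω^ a + d)
  ω^-acc aa (acc rd) = acc λ
    { {𝟎}        _                       → acc λ { (_ , ()) }
    ; {ω^ b + e} (c , exp≺ p)            → smaller-acc aa (ω^ b + e) (exp≺ p) c
    ; {ω^ b + e} ((_ , _ , ce) , rem≺ p) → ω^-acc aa (rd (ce , p)) }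

  smaller-acc : ∀ {a} → Acc _≺ᶜ_ a → ∀ x → x ≺ ω^ a + 𝟎 → CNF x → Acc _≺ᶜ_ x
  smaller-acc _ 𝟎 _ _ = acc λ { (_ , ()) }
  smaller-acc (acc ra) (ω^ b + e) (exp≺ p) (cb , h , ce) =
    ω^-acc (ra (cb , p)) (smaller-acc (acc ra) e (HeadBound⇒≺ e h p) ce)

≺ᶜ-acc : ∀ x → CNF x → Acc _≺ᶜ_ x
≺ᶜ-acc 𝟎          _            = acc λ { (_ , ()) }
≺ᶜ-acc (ω^ a + d) (ca , _ , cd) = ω^-acc (≺ᶜ-acc a ca) (≺ᶜ-acc d cd)

-- c ◃ x: x is nonzero and its last exponent is at least c.
data _◃_ (c : Ord) : Ord → Set where
  last : ∀ {a} → c ⪯ a → c ◃ ω^ a + 𝟎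
  skip : ∀ {a d} → c ◃ d → c ◃ ω^ a + d

◃-down : ∀ {b c x} → b ⪯ c → c ◃ x → b ◃ x
◃-down p (last q) = last (⪯-trans p q)
◃-down p (skip q) = skip (◃-down p q)

◃⇒𝟎≺ : ∀ {c x} → c ◃ x → 𝟎 ≺ x
◃⇒𝟎≺ (last _) = 𝟎≺
◃⇒𝟎≺ (skip _) = 𝟎≺

◃⇒⪯ : ∀ {c a d} → CNF (ω^ a + d) → c ◃ ω^ a + d → c ⪯ a
◃⇒⪯ _ (last p) = p
◃⇒⪯ {d = ω^ _ + _} (_ , h , cd) (skip p) = ⪯-trans (◃⇒⪯ cd p) h

-- Ordinal sum m + ω^c: in a normal form no exponent exceeds the leading one, so if that is below
-- `c` everything is absorbed.
_+ω^_ : Ord → Ord → Ord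
𝟎          +ω^ c = ω^ c + 𝟎
(ω^ a + d) +ω^ c with ≺-or-⪰ a c
... | inj₁ _ = ω^ c + 𝟎
... | inj₂ _ = ω^ a + (d +ω^ c)

≺-+ω^ : ∀ m c → m ≺ m +ω^ c
≺-+ω^ 𝟎          c = 𝟎≺
≺-+ω^ (ω^ a + d) c with ≺-or-⪰ a c
... | inj₁ p = exp≺ p
... | inj₂ _ = rem≺ (≺-+ω^ d c)

+ω^-HeadBound : ∀ d {a c} → HeadBound d a → c ⪯ a → HeadBound (d +ω^ c) a
+ω^-HeadBound 𝟎          _ p = p
+ω^-HeadBound (ω^ b + _) {c = c} h p with ≺-or-⪰ b c
... | inj₁ _ = p
... | inj₂ _ = h

+ω^-CNF : ∀ m {c} → CNF m → CNF c → CNF (m +ω^ c)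
+ω^-CNF 𝟎          _ cc = cc , tt , tt
+ω^-CNF (ω^ a + d) {c} (ca , h , cd) cc with ≺-or-⪰ a c
... | inj₁ _ = cc , tt , tt
... | inj₂ q = ca , +ω^-HeadBound d h q , +ω^-CNF d cd cc

◃-+ω^ : ∀ m c → c ◃ m +ω^ c
◃-+ω^ 𝟎          c = last (inj₂ refl)
◃-+ω^ (ω^ a + d) c with ≺-or-⪰ a c
... | inj₁ _ = last (inj₂ refl)
... | inj₂ _ = skip (◃-+ω^ d c)

-- x is a multiple of ω^ (c + 1), hence a limit of multiples of ω^ c.
+ω^-≺ : ∀ {m x p c} → CNF x → m ≺ x → p ◃ x → c ≺ p → m +ω^ c ≺ x
+ω^-≺ cx 𝟎≺ l q = exp≺ (≺-⪯-trans q (◃⇒⪯ cx l))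
+ω^-≺ {ω^ a + _} {c = c} cx (exp≺ r) l q with ≺-or-⪰ a c
... | inj₁ _ = exp≺ (≺-⪯-trans q (◃⇒⪯ cx l))
... | inj₂ _ = exp≺ r
+ω^-≺ {ω^ a + _} {c = c} cx (rem≺ r) l q with ≺-or-⪰ a c
... | inj₁ _ = exp≺ (≺-⪯-trans q (◃⇒⪯ cx l))
+ω^-≺ cx (rem≺ ()) (last _) q | inj₂ _
+ω^-≺ (_ , _ , cd) (rem≺ r) (skip l) q | inj₂ _ = rem≺ (+ω^-≺ cd r l q)

-- Ignatiev's frame

Below : ∀ {n} → Vec Ord n → Ord → Set
Below []      x = ⊤
Below (y ∷ _) x = y ◃ x

-- Finite segments of Ignatiev's sequences; as `_◃_` forces its right side to be nonzero, only the
-- final coordinate may be `𝟎`.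
Valid : ∀ {n} → Vec Ord n → Set
Valid []      = ⊤
Valid (x ∷ w) = CNF x × Below w x × Valid w

R : ∀ {n} → ℕ → Vec Ord n → Vec Ord n → Set
R k       []      []      = ⊥
R zero    (x ∷ _) (y ∷ _) = y ≺ x
R (suc k) (x ∷ v) (y ∷ w) = x ≡ y × R k v w

module _ where
  private variable
    n j k : ℕ
    u v w : Vec Ord n

  R-trans : R k u v → R k v w → R k u w
  R-trans {k = zero}  {u = _ ∷ _} {_ ∷ _} {_ ∷ _} p q = ≺-trans q p
  R-trans {k = suc _} {u = _ ∷ _} {_ ∷ _} {_ ∷ _} (refl , p) (refl , q) = refl , R-trans p q
  R-trans {u = []} {[]} ()

  -- An `R k` step fixes all coordinates before k, and `R j` looks only at the first j + 1
  -- coordinates of its source.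
  R-invariant : j ℕ.< k → R k u v → R j u w ⇔ R j v w
  R-invariant {u = []} {[]} _ ()
  R-invariant {j = zero} {suc _} {u = _ ∷ _} {_ ∷ _} {_ ∷ _} _ (refl , _) = ⇔-id _
  R-invariant {j = suc _} {suc _} {u = _ ∷ _} {_ ∷ _} {_ ∷ _} (s≤s l) (refl , p) =
    ⇔-id _ ×-⇔ R-invariant l p

  R-trans-≤ : j ℕ.≤ k → R k u v → R j v w → R j u w
  R-trans-≤ l p q with ℕ.m≤n⇒m<n∨m≡n l
  ... | inj₁ l′   = Equivalence.from (R-invariant l′ p) q
  ... | inj₂ refl = R-trans p q

  R-Below : ∀ {x} → R k u v → Below u x → Below v x
  R-Below {zero}  {u = _ ∷ _} {_ ∷ _} p b = ◃-down (inj₁ p) b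
  R-Below {suc _} {u = _ ∷ _} {_ ∷ _} (refl , _) b = b
  R-Below {u = []} {[]} ()

  R-nonzero : ∀ {x} → R k u v → Below u x → 𝟎 ≺ x
  R-nonzero {u = _ ∷ _} _ b = ◃⇒𝟎≺ b
  R-nonzero {u = []} {[]} ()

  R-acc : ∀ k (w : Vec Ord n) → Valid w → Acc (λ v u → Valid v × R k u v) w
  R-acc k [] _ = acc λ { {[]} (_ , ()) }
  R-acc zero (x ∷ w) (cx , _) = go w (≺ᶜ-acc x cx)
    where
    go : ∀ {x} w → Acc _≺ᶜ_ x → Acc (λ v u → Valid v × R zero u v) (x ∷ w)
    go _ (acc r) = acc λ { {y ∷ v} ((cy , _) , p) → go v (r (cy , p)) }
  R-acc (suc k) (x ∷ w) (_ , _ , vw) = go (R-acc k w vw)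
    where
    go : ∀ {w} → Acc (λ v u → Valid v × R k u v) w →
         Acc (λ v u → Valid v × R (suc k) u v) (x ∷ w)
    go (acc r) = acc λ { {y ∷ v} ((_ , _ , vv) , refl , p) → go (r (vv , p)) }

-- Soundness of the closed fragment of GLP

module Soundness {A : Set} (_≟_ : DecidableEquality A) where

  infix 4 _,_⊩_

  _,_⊩_ : ∀ {n} → (A → ℕ) → Vec Ord n → Fm A → Set
  -- A derivation of a closed formula may pass through variables; reading them as true closes such
  -- formulas.
  f , w ⊩ var _   = ⊤
  f , w ⊩ ⊤'      = ⊤
  f , w ⊩ ¬' φ    = ¬ (f , w ⊩ φ)
  f , w ⊩ φ ∧' ψ  = (f , w ⊩ φ) × (f , w ⊩ ψ)
  f , w ⊩ [ α ] φ = ∀ v → Valid v → R (f α) w v → f , v ⊩ φ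

  -- Only conjunction, negation and universal quantification enter the semantics, and they preserve
  -- stability. Classical arguments under `¬ ¬` can thus establish truth.
  stable : ∀ {n} f {w : Vec Ord n} φ → ¬ ¬ (f , w ⊩ φ) → f , w ⊩ φ
  stable f (var _)   h = tt
  stable f ⊤'        h = tt
  stable f (¬' φ)    h = negated-stable h
  stable f (φ ∧' ψ)  h = stable f φ (¬¬-map proj₁ h) , stable f ψ (¬¬-map proj₂ h)
  stable f ([ α ] φ) h v vv r = stable f φ (¬¬-map (λ b → b v vv r) h)

  private
    -- The double-negation monad, in which the `do` blocks below are read.
    _>>=_ : ∀ {P Q : Set} → ¬ ¬ P → (P → ¬ ¬ Q) → ¬ ¬ Q
    (m >>= g) q = m λ p → g p q

    return : ∀ {P : Set} → P → ¬ ¬ P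
    return p q = q p

  upper-bound : ∀ {a m m′} → CNF m → CNF m′ → m ≺ a → m′ ≺ a →
                Σ Ord λ b → CNF b × b ≺ a × m ⪯ b × m′ ⪯ b
  upper-bound {m = m} {m′} c c′ p p′ with ≺-or-⪰ m m′
  ... | inj₁ q = m′ , c′ , p′ , inj₁ q , inj₂ refl
  ... | inj₂ q = m  , c  , p  , inj₂ refl , q

  -- Truth of a formula [ α ] ψ with f α = 0 depends on the first coordinate b
  -- only, and it is constant for b in an interval (m, a].
  reduct : ∀ {n} f {a} → 𝟎 ≺ a → (φ : Fm A) →
    ¬ ¬ Σ (Fm A) λ φ′ → Σ Ord λ m → CNF m × m ≺ a ×
      (∀ {b} (w : Vec Ord n) → m ≺ b → b ⪯ a → Valid (b ∷ w) →
        f , (b ∷ w) ⊩ φ ⇔ (pred ∘ f) , w ⊩ φ′)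
  reduct f p (var _) = return (⊤' , 𝟎 , tt , p , λ {_} _ _ _ _ → ⇔-id _)
  reduct f p ⊤'      = return (⊤' , 𝟎 , tt , p , λ {_} _ _ _ _ → ⇔-id _)
  reduct f p (¬' φ)  = do
    φ′ , m , c , q , e ← reduct f p φ
    return (¬' φ′ , m , c , q , λ {_} w r s v → ¬-cong-⇔ (e w r s v))
  reduct f p (φ ∧' ψ) = do
    φ′ , m , c , q , e ← reduct f p φ
    ψ′ , m′ , c′ , q′ , e′ ← reduct f p ψ
    let b , cb , l , r , r′ = upper-bound c c′ q q′
    return (φ′ ∧' ψ′ , b , cb , l , λ {_} w s t v →
      e w (⪯-≺-trans r s) t v ×-⇔ e′ w (⪯-≺-trans r′ s) t v)
  reduct {n} f {a} p ([ α ] φ) with f α in eq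
  -- Successors keep the first coordinate `b`, so the interval found for φ still serves at each of
  -- them.
  ... | suc k = do
    φ′ , m , c , q , e ← reduct f p φ
    return ([ α ] φ′ , m , c , q , λ {b} w r s (cb , bw , vw) → mk⇔
      (λ h v vv Rwv → let Rwv′ = subst (λ i → R (pred i) w v) eq Rwv
                          vbv = cb , R-Below Rwv′ bw , vv in
        Equivalence.to (e v r s vbv) (h (b ∷ v) vbv (refl , Rwv′)))
      λ { h (b ∷ v) vbv@(_ , _ , vv) (refl , Rwv) →
        Equivalence.from (e v r s vbv) (h v vv (subst (λ i → R (pred i) w v) (sym eq) Rwv)) })
  -- A box true at `a` is true for all smaller `b`. Otherwise the first coordinate `y` of a
  -- counterexample is the threshold: every `b` above it still sees that counterexample.
  ... | zero = ¬¬-excluded-middle >>= λ where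
    (yes h) → return (⊤' , 𝟎 , tt , p , λ {_} w _ s _ → mk⇔ _
      λ { _ (y ∷ v) vv q → h y v vv (≺-⪯-trans q s) })
    (no ¬h) → do
      y , v , vv , q , ¬φ ← (λ ¬∃ → ¬h λ y v vv q → stable f φ λ ¬φ → ¬∃ (y , v , vv , q , ¬φ))
      return (¬' ⊤' , y , proj₁ vv , q , λ {_} w r _ _ → mk⇔
        (λ h → ⊥-elim (¬φ (h (y ∷ v) vv r))) λ h → ⊥-elim (h tt))

  -- The frame condition behind axiom (v). A step lowering a later coordinate is imitated
  -- by lowering the first one from a to m + ω^ d, where above m the truth of the formulas
  -- which depend only on the first coordinate no longer changes.
  reflect : ∀ {n} f φ {j k} {x y : Vec Ord n} → j ℕ.≤ k → Valid x → Valid y → R k x y →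
    ¬ ¬ Σ (Vec Ord n) λ z → Valid z × R j x z × (f , z ⊩ φ ⇔ f , y ⊩ φ)
  reflect f φ {x = []} {[]} _ _ _ ()
  reflect f φ {zero} {zero} {y = y} _ _ vy r = return (y , vy , r , ⇔-id _)
  reflect f φ {zero} {suc k} {a ∷ x} {a ∷ y} _ (ca , bx , vx) vay@(_ , by , vy) (refl , r) = do
    let 𝟎≺a = R-nonzero r bx
    φ′ , m , cm , m≺a , e ← reduct f 𝟎≺a φ
    -- With index zero the first coordinate `d` of `z` is below that of `x`, which leaves room for m
    -- + ω^d below `a`.
    z , vz , s , e′ ← reflect (pred ∘ f) φ′ {zero} z≤n vx vy r
    return (raise bx vx vay m cm m≺a e z vz s e′)
    where
    raise : ∀ {n φ′ a} {x y : Vec Ord n} → Below x a → Valid x → Valid (a ∷ y) →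
            ∀ m → CNF m → m ≺ a →
            (∀ {b} (w : Vec Ord n) → m ≺ b → b ⪯ a → Valid (b ∷ w) →
              f , (b ∷ w) ⊩ φ ⇔ (pred ∘ f) , w ⊩ φ′) →
            ∀ z → Valid z → R zero x z → ((pred ∘ f) , z ⊩ φ′ ⇔ (pred ∘ f) , y ⊩ φ′) →
            Σ (Vec Ord (suc n)) λ z → Valid z × R zero (a ∷ x) z × (f , z ⊩ φ ⇔ f , (a ∷ y) ⊩ φ)
    raise {x = c ∷ x} bx vx vay m cm m≺a e (d ∷ z) vz@(cd , _) d≺c e′ =
      (m +ω^ d) ∷ d ∷ z , vbz , b≺a ,
      (⇔-sym (e _ m≺a (inj₂ refl) vay) ⇔-∘ (e′ ⇔-∘ e (d ∷ z) (≺-+ω^ m d) (inj₁ b≺a) vbz))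
      where
      b≺a : m +ω^ d ≺ _
      b≺a = +ω^-≺ (proj₁ vay) m≺a bx d≺c
      vbz : Valid ((m +ω^ d) ∷ d ∷ z)
      vbz = +ω^-CNF m cm cd , ◃-+ω^ m d , vz
    raise {x = []} _ _ _ _ _ _ _ [] _ ()
  reflect f φ {suc j} {suc k} {a ∷ x} {a ∷ y} (s≤s l) (ca , bx , vx) vay@(_ , by , vy) (refl , r) = do
    φ′ , m , cm , m≺a , e ← reduct f (R-nonzero r bx) φ
    z , vz , s , e′ ← reflect (pred ∘ f) φ′ l vx vy r
    let vaz = ca , R-Below s bx , vz
        e″ = λ w → e w m≺a (inj₂ refl)
    return (a ∷ z , vaz , (refl , s) , (⇔-sym (e″ y vay) ⇔-∘ (e′ ⇔-∘ e″ z vaz)))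

  -- Tautologies in the model

  Fm-≟ : DecidableEquality (Fm A)
  Fm-≟ (var m) (var n) = map′ (cong var) (λ { refl → refl }) (m ℕ.≟ n)
  Fm-≟ ⊤' ⊤' = yes refl
  Fm-≟ (¬' φ) (¬' ψ) = map′ (cong ¬'_) (λ { refl → refl }) (Fm-≟ φ ψ)
  Fm-≟ (φ ∧' φ′) (ψ ∧' ψ′) =
    map′ (λ { (p , q) → cong₂ _∧'_ p q }) (λ { refl → refl , refl }) (Fm-≟ φ ψ ×-dec Fm-≟ φ′ ψ′)
  Fm-≟ ([ α ] φ) ([ β ] ψ) =
    map′ (λ { (p , q) → cong₂ [_]_ p q }) (λ { refl → refl , refl }) ((α ≟ β) ×-dec Fm-≟ φ ψ)
  Fm-≟ (var _) ⊤' = no λ ()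
  Fm-≟ (var _) (¬' _) = no λ ()
  Fm-≟ (var _) (_ ∧' _) = no λ ()
  Fm-≟ (var _) ([ _ ] _) = no λ ()
  Fm-≟ ⊤' (var _) = no λ ()
  Fm-≟ ⊤' (¬' _) = no λ ()
  Fm-≟ ⊤' (_ ∧' _) = no λ ()
  Fm-≟ ⊤' ([ _ ] _) = no λ ()
  Fm-≟ (¬' _) (var _) = no λ ()
  Fm-≟ (¬' _) ⊤' = no λ ()
  Fm-≟ (¬' _) (_ ∧' _) = no λ ()
  Fm-≟ (¬' _) ([ _ ] _) = no λ ()
  Fm-≟ (_ ∧' _) (var _) = no λ ()
  Fm-≟ (_ ∧' _) ⊤' = no λ ()
  Fm-≟ (_ ∧' _) (¬' _) = no λ ()
  Fm-≟ (_ ∧' _) ([ _ ] _) = no λ ()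
  Fm-≟ ([ _ ] _) (var _) = no λ ()
  Fm-≟ ([ _ ] _) ⊤' = no λ ()
  Fm-≟ ([ _ ] _) (¬' _) = no λ ()
  Fm-≟ ([ _ ] _) (_ ∧' _) = no λ ()

  -- Excluded middle can be moved under one double negation for finitely many formulas only; outside
  -- `Γ` the valuation is arbitrary.
  ¬¬-valuation : (P : Fm A → Set) (Γ : List (Fm A)) →
    ¬ ¬ Σ (Fm A → Bool) λ ρ → All (λ ψ → Reflects (P ψ) (ρ ψ)) Γ
  ¬¬-valuation P [] = return ((λ _ → true) , [])
  ¬¬-valuation P (ψ ∷ Γ) = do
    ρ , h ← ¬¬-valuation P Γ
    Pψ? ← ¬¬-excluded-middle {A = P ψ}
    return (override ρ Pψ? , override-head ρ Pψ? ∷ override-tail ρ Pψ? h)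
    where
    override : (Fm A → Bool) → Dec (P ψ) → Fm A → Bool
    override ρ Pψ? χ with Fm-≟ χ ψ
    ... | yes _ = Dec.does Pψ?
    ... | no _  = ρ χ
    override-head : ∀ ρ (Pψ? : Dec (P ψ)) → Reflects (P ψ) (override ρ Pψ? ψ)
    override-head ρ Pψ? with Fm-≟ ψ ψ
    ... | yes _ = Dec.proof Pψ?
    ... | no ne = ⊥-elim (ne refl)
    override-tail : ∀ ρ (Pψ? : Dec (P ψ)) {Γ} → All (λ χ → Reflects (P χ) (ρ χ)) Γ →
                    All (λ χ → Reflects (P χ) (override ρ Pψ? χ)) Γ
    override-tail ρ Pψ? [] = []
    override-tail ρ Pψ? {χ ∷ _} (r ∷ h) = go ∷ override-tail ρ Pψ? h
      where
      go : Reflects (P χ) (override ρ Pψ? χ)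
      go with Fm-≟ χ ψ
      ... | yes refl = Dec.proof Pψ?
      ... | no _     = r

  atoms : Fm A → List (Fm A)
  atoms (¬' φ)    = atoms φ
  atoms (φ ∧' ψ)  = atoms φ ++ atoms ψ
  atoms ⊤'        = []
  atoms φ         = φ ∷ []

  eval-reflects : ∀ {n} f {w : Vec Ord n} {ρ} φ →
    All (λ ψ → Reflects (f , w ⊩ ψ) (ρ ψ)) (atoms φ) → Reflects (f , w ⊩ φ) (eval ρ φ)
  eval-reflects f (var _)   (r ∷ []) = r
  eval-reflects f ⊤'        _        = ofʸ tt
  eval-reflects f (¬' φ)    h        = ¬-reflects (eval-reflects f φ h)
  eval-reflects f (φ ∧' ψ)  h        =
    eval-reflects f φ (++⁻ˡ (atoms φ) h) ×-reflects eval-reflects f ψ (++⁻ʳ (atoms φ) h)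
  eval-reflects f ([ _ ] _) (r ∷ []) = r

  tautology-sound : ∀ {n} f {w : Vec Ord n} φ → Tautology φ → f , w ⊩ φ
  tautology-sound f {w} φ t = stable f φ do
    ρ , h ← ¬¬-valuation (f , w ⊩_) (atoms φ)
    return (invert (subst (Reflects _) (t ρ) (eval-reflects f φ h)))

  -- Soundness of the modal axioms

  ⊩-⇒ : ∀ {n} f {w : Vec Ord n} φ ψ → (f , w ⊩ φ → f , w ⊩ ψ) → f , w ⊩ φ ⇒ ψ
  ⊩-⇒ f φ ψ h (p , ¬q) = ¬q (h p)

  ⊩-mp : ∀ {n} f {w : Vec Ord n} φ ψ → f , w ⊩ φ ⇒ ψ → f , w ⊩ φ → f , w ⊩ ψ
  ⊩-mp f φ ψ h p = stable f ψ λ ¬q → h (p , ¬q)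

  -- By `reflect` each `R k` successor agrees on φ with some `R j` successor; `stable` removes the
  -- double negation.
  box-mono : ∀ {n} f {w : Vec Ord n} φ {j k} → Valid w → j ℕ.≤ k →
    (∀ v → Valid v → R j w v → f , v ⊩ φ) → ∀ v → Valid v → R k w v → f , v ⊩ φ
  box-mono f φ vw l h v vv r = stable f φ do
    z , vz , s , e ← reflect f φ l vw vv r
    return (Equivalence.to e (h z vz s))

  löb : ∀ {n} f {w : Vec Ord n} α φ → f , w ⊩ [ α ] ([ α ] φ ⇒ φ) → f , w ⊩ [ α ] φ
  löb f {w} α φ h v vv r = go vv r (R-acc (f α) v vv)
    where
    go : ∀ {v} → Valid v → R (f α) w v → Acc (λ v u → Valid v × R (f α) u v) v → f , v ⊩ φ
    go vv r (acc rs) = ⊩-mp f ([ α ] φ) φ (h _ vv r) λ u vu s →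
      go vu (R-trans r s) (rs (vu , s))

  module _ (_<_ : A → A → Set) where
    open GLP _<_

    lows : ∀ {φ} → ⊢ φ → List A
    lows (taut _)      = []
    lows axK           = []
    lows axL           = []
    lows (ax3 _)       = []
    lows (ax4 {α} _)   = α ∷ []
    lows (ax5 _)       = []
    lows (mp d e)      = lows d ++ lows e
    lows (nec d)       = lows d

    sound : ∀ {n} f → (∀ {α β} → α ≤ β → f α ℕ.≤ f β) → ∀ {φ} (d : ⊢ φ) →
      (∀ {α β} → α ∈ lows d → α < β → f α ℕ.< f β) →
      ∀ (w : Vec Ord n) → Valid w → f , w ⊩ φ
    sound f mono (taut {φ} t) _ w vw = tautology-sound f φ t
    sound f mono (axK {α} {χ} {ψ}) _ w vw =
      ⊩-⇒ f ([ α ] (χ ⇒ ψ)) ([ α ] χ ⇒ [ α ] ψ) λ h →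
        ⊩-⇒ f ([ α ] χ) ([ α ] ψ) λ g v vv r → ⊩-mp f χ ψ (h v vv r) (g v vv r)
    sound f mono (axL {α} {χ}) _ w vw =
      ⊩-⇒ f ([ α ] ([ α ] χ ⇒ χ)) ([ α ] χ) (löb f α χ)
    sound f mono (ax3 {α} {β} {χ} l) _ w vw =
      ⊩-⇒ f ([ α ] χ) ([ β ] [ α ] χ) λ h v vv r u vu s →
        h u vu (R-trans-≤ (mono l) r s)
    sound f mono (ax4 {α} {β} {χ} l) strict w vw =
      ⊩-⇒ f (⟨ α ⟩ χ) ([ β ] ⟨ α ⟩ χ) λ h v vv r g → h λ u vu s →
        g u vu (Equivalence.to (R-invariant (strict (here refl) l) r) s)
    sound f mono (ax5 {α} {β} {χ} l) _ w vw =
      ⊩-⇒ f ([ α ] χ) ([ β ] χ) (box-mono f χ vw (mono l))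
    sound f mono (mp {φ} {ψ} d e) strict w vw =
      ⊩-mp f φ ψ (sound f mono d (strict ∘ ∈-++⁺ˡ) w vw)
                 (sound f mono e (strict ∘ ∈-++⁺ʳ (lows d)) w vw)
    sound f mono (nec d) strict w vw v vv r = sound f mono d strict v vv

  -- Consistency of positive formulas

  data Positive : Fm A → Set where
    ⊤⁺   : Positive ⊤'
    _∧⁺_ : ∀ {φ ψ} → Positive φ → Positive ψ → Positive (φ ∧' ψ)
    ⟨_⟩⁺ : ∀ {φ} α → Positive φ → Positive (⟨ α ⟩ φ)

  depth : ∀ {φ} → Positive φ → ℕ
  depth ⊤⁺         = 0
  depth (p ∧⁺ q)   = depth p ℕ.⊔ depth q
  depth (⟨ _ ⟩⁺ p) = suc (depth p)

  finite : ℕ → Ord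
  finite zero    = 𝟎
  finite (suc n) = ω^ 𝟎 + finite n

  finite-CNF : ∀ n → CNF (finite n)
  finite-CNF zero    = tt
  finite-CNF (suc n) = tt , head≤𝟎 n , finite-CNF n
    where
    head≤𝟎 : ∀ n → HeadBound (finite n) 𝟎
    head≤𝟎 zero    = tt
    head≤𝟎 (suc _) = inj₂ refl

  finite-mono : ∀ {m n} → m ℕ.≤ n → finite m ⪯ finite n
  finite-mono {zero} {zero} z≤n = inj₂ refl
  finite-mono {zero} {suc _} z≤n = inj₁ 𝟎≺
  finite-mono (s≤s l) with finite-mono l
  ... | inj₁ p = inj₁ (rem≺ p)
  ... | inj₂ p = inj₂ (cong (ω^ 𝟎 +_) p)

  finite-suc : ∀ n → finite n ≺ finite (suc n)
  finite-suc zero    = 𝟎≺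
  finite-suc (suc n) = rem≺ (finite-suc n)

  tower : ℕ → ℕ → Ord
  tower K zero    = finite K
  tower K (suc n) = ω^ tower K n + 𝟎

  -- The coordinates are `tower K n`, ..., `tower K 1`, `finite r`. As `tower K 1` has exponent
  -- `finite K`, r ≤ K gives validity, and lowering `r` is an `R n` step.
  point : ℕ → ℕ → (n : ℕ) → Vec Ord (suc n)
  point K r zero    = finite r ∷ []
  point K r (suc n) = tower K (suc n) ∷ point K r n

  tower-CNF : ∀ K n → CNF (tower K n)
  tower-CNF K zero    = finite-CNF K
  tower-CNF K (suc n) = tower-CNF K n , tt , tt

  point-valid : ∀ {K r} n → r ℕ.≤ K → Valid (point K r n)
  point-valid {r = r} zero l = finite-CNF r , tt , tt
  point-valid {K} (suc n) l = tower-CNF K (suc n) , head-below n , point-valid n l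
    where
    head-below : ∀ n → Below (point K _ n) (tower K (suc n))
    head-below zero    = last (finite-mono l)
    head-below (suc n) = last (inj₂ refl)

  point-R : ∀ {K} r n → R n (point K (suc r) n) (point K r n)
  point-R r zero    = finite-suc r
  point-R r (suc n) = refl , point-R r n

  -- Each nested diamond spends one unit of `r` on a step along `R n`; as f α ≤ n, `box-mono` makes
  -- that step serve for ⟨α⟩.
  positive-true : ∀ f {n K} → (∀ α → f α ℕ.≤ n) → ∀ {φ} (p : Positive φ) r → depth p ℕ.≤ r →
                  r ℕ.≤ K → f , point K r n ⊩ φ
  positive-true f b ⊤⁺ r _ _ = tt
  positive-true f b (p ∧⁺ q) r l m =
    positive-true f b p r (ℕ.m⊔n≤o⇒m≤o (depth p) _ l) m ,
    positive-true f b q r (ℕ.m⊔n≤o⇒n≤o (depth p) _ l) m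
  positive-true f {n} b (⟨_⟩⁺ {φ} α p) (suc r) (s≤s l) m h =
    box-mono f (¬' φ) (point-valid n m) (b α) h _ (point-valid n r≤K) (point-R r n)
      (positive-true f b p r l r≤K)
    where r≤K = ℕ.≤-trans (ℕ.n≤1+n r) m

module Consistency {A : Set} {_<_ : A → A → Set} (sto : IsStrictTotalOrder _≡_ _<_) where
  open IsStrictTotalOrder sto using (_≟_; _<?_; irrefl) renaming (trans to <-trans)
  open Soundness _≟_
  open GLP _<_

  -- Finite ranks of modalities

  rank : List A → A → ℕ
  rank []      α = 0
  rank (γ ∷ Γ) α = (if Dec.does (γ <? α) then 1 else 0) ℕ.+ rank Γ α

  rank-bound : ∀ Γ α → rank Γ α ℕ.≤ length Γ
  rank-bound []      α = z≤n
  rank-bound (γ ∷ Γ) α with γ <? α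
  ... | yes _ = s≤s (rank-bound Γ α)
  ... | no _  = ℕ.m≤n⇒m≤1+n (rank-bound Γ α)

  rank-mono-< : ∀ Γ {α β} → α < β → rank Γ α ℕ.≤ rank Γ β
  rank-mono-< [] l = z≤n
  rank-mono-< (γ ∷ Γ) {α} {β} l with γ <? α | γ <? β
  ... | yes _ | yes _ = s≤s (rank-mono-< Γ l)
  ... | yes p | no ¬p = ⊥-elim (¬p (<-trans p l))
  ... | no _  | yes _ = ℕ.m≤n⇒m≤1+n (rank-mono-< Γ l)
  ... | no _  | no _  = rank-mono-< Γ l

  rank-mono : ∀ Γ {α β} → α ≤ β → rank Γ α ℕ.≤ rank Γ β
  rank-mono Γ (inj₁ l)    = rank-mono-< Γ l
  rank-mono Γ (inj₂ refl) = ℕ.≤-refl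

  -- The occurrence of `α` in `Γ` is counted for `β` but not for `α`.
  rank-strict : ∀ {Γ α β} → α ∈ Γ → α < β → rank Γ α ℕ.< rank Γ β
  rank-strict {γ ∷ Γ} {α} {β} i l with γ <? α | γ <? β
  rank-strict {γ ∷ Γ} (here refl) l | yes p | _     = ⊥-elim (irrefl refl p)
  rank-strict {γ ∷ Γ} (here refl) l | no _  | yes _ = s≤s (rank-mono-< Γ l)
  rank-strict {γ ∷ Γ} (here refl) l | no _  | no ¬p = ⊥-elim (¬p l)
  rank-strict {γ ∷ Γ} (there i)   l | yes _ | yes _ = s≤s (rank-strict i l)
  rank-strict {γ ∷ Γ} (there i)   l | yes p | no ¬p = ⊥-elim (¬p (<-trans p l))
  rank-strict {γ ∷ Γ} (there i)   l | no _  | yes _ = ℕ.m≤n⇒m≤1+n (rank-strict i l)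
  rank-strict {γ ∷ Γ} (there i)   l | no _  | no _  = rank-strict i l

  -- Only finitely many instances of axiom (iv) occur in a proof, so a monotone
  -- map from modalities to numbers need be strict only where they require it.
  positive-consistent : ∀ {φ} → Positive φ → ¬ ⊢ (¬' φ)
  positive-consistent p d =
    sound _<_ f (rank-mono Γ) d rank-strict (point r r n) (point-valid n ℕ.≤-refl)
      (positive-true f (rank-bound Γ) p r ℕ.≤-refl ℕ.≤-refl)
    where
    Γ = lows _<_ d
    f = rank Γ
    n = length Γ
    r = depth p

-- Derived rules of GLP

module PropositionalReasoning {A : Set} (_<_ : A → A → Set) where
  open GLP _<_

  nth : ∀ {B : Set} → B → List B → ℕ → B
  nth d []       _       = d
  nth d (x ∷ xs) zero    = x
  nth d (x ∷ xs) (suc i) = nth d xs i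

  -- Over `⊥` there are no modalities, so `Fm ⊥` is the type of propositional schemata.
  sub : List (Fm A) → Fm ⊥ → Fm A
  sub σ (var i)  = nth ⊤' σ i
  sub σ ⊤'       = ⊤'
  sub σ (¬' s)   = ¬' sub σ s
  sub σ (s ∧' t) = sub σ s ∧' sub σ t

  value : Fm ⊥ → List Bool → Bool
  value (var i)  bs = nth true bs i
  value ⊤'       bs = true
  value (¬' s)   bs = not (value s bs)
  value (s ∧' t) bs = value s bs ∧ value t bs

  valid : ℕ → (List Bool → Bool) → Bool
  valid zero    f = f []
  valid (suc n) f = valid n (f ∘ (true ∷_)) ∧ valid n (f ∘ (false ∷_))

  nth-map : ∀ {B C : Set} (g : B → C) d xs i → g (nth d xs i) ≡ nth (g d) (map g xs) i
  nth-map g d []       i       = refl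
  nth-map g d (x ∷ xs) zero    = refl
  nth-map g d (x ∷ xs) (suc i) = nth-map g d xs i

  eval-sub : ∀ ρ σ s → eval ρ (sub σ s) ≡ value s (map (eval ρ) σ)
  eval-sub ρ σ (var i)  = nth-map (eval ρ) ⊤' σ i
  eval-sub ρ σ ⊤'       = refl
  eval-sub ρ σ (¬' s)   = cong not (eval-sub ρ σ s)
  eval-sub ρ σ (s ∧' t) = cong₂ _∧_ (eval-sub ρ σ s) (eval-sub ρ σ t)

  valid-sound : ∀ {B : Set} (g : B → Bool) xs f → T (valid (length xs) f) → T (f (map g xs))
  valid-sound g []       f v = v
  valid-sound g (x ∷ xs) f v with g x | Equivalence.to T-∧ v
  ... | true  | v₁ , _ = valid-sound g xs (f ∘ (true ∷_)) v₁
  ... | false | _ , v₂ = valid-sound g xs (f ∘ (false ∷_)) v₂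

  -- Variable i of the schema s stands for the i-th formula of σ; the implicit
  -- argument evaluates the truth table, so it is solved by computation.
  prop : ∀ s σ → {T (valid (length σ) (value s))} → ⊢ sub σ s
  prop s σ {v} = taut λ ρ →
    trans (eval-sub ρ σ s) (Equivalence.to T-≡ (valid-sound (eval ρ) σ (value s) v))

  infixl 6 _·_
  _·_ : ∀ {φ ψ} → ⊢ (φ ⇒ ψ) → ⊢ φ → ⊢ ψ
  _·_ = mp

  p q r s : Fm ⊥
  p = var 0
  q = var 1
  r = var 2
  s = var 3

module Modal {A : Set} (_<_ : A → A → Set) where
  open GLP _<_
  open PropositionalReasoning _<_

  private variable
    α β : A
    φ ψ χ τ : Fm A

  infixr 5.5 _∨_
  _∨_ : ∀ {B : Set} → Fm B → Fm B → Fm B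
  φ ∨ ψ = ¬' (¬' φ ∧' ¬' ψ)

  infix 3 _≼_ _≈_
  _≼_ : Fm A → Fm A → Set
  φ ≼ ψ = ⊢ (φ ⇒ ψ)

  _≈_ : Fm A → Fm A → Set
  φ ≈ ψ = (φ ≼ ψ) × (ψ ≼ φ)

  ≼-refl : φ ≼ φ
  ≼-refl = prop (p ⇒ p) (_ ∷ [])

  infixr 5 _⨾_
  _⨾_ : φ ≼ ψ → ψ ≼ χ → φ ≼ χ
  d ⨾ e = prop ((p ⇒ q) ⇒ (q ⇒ r) ⇒ (p ⇒ r)) (_ ∷ _ ∷ _ ∷ []) · d · e

  ∧-mono : φ ≼ ψ → χ ≼ τ → φ ∧' χ ≼ ψ ∧' τ
  ∧-mono d e = prop ((p ⇒ q) ⇒ (r ⇒ s) ⇒ (p ∧' r ⇒ q ∧' s)) (_ ∷ _ ∷ _ ∷ _ ∷ []) · d · e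

  ≼-∧ : χ ≼ φ → χ ≼ ψ → χ ≼ φ ∧' ψ
  ≼-∧ d e = prop ((p ⇒ q) ⇒ (p ⇒ r) ⇒ (p ⇒ q ∧' r)) (_ ∷ _ ∷ _ ∷ []) · d · e

  ∧-≼ˡ : φ ∧' ψ ≼ φ
  ∧-≼ˡ = prop (p ∧' q ⇒ p) (_ ∷ _ ∷ [])

  ∧-≼ʳ : φ ∧' ψ ≼ ψ
  ∧-≼ʳ = prop (p ∧' q ⇒ q) (_ ∷ _ ∷ [])

  ≼-⊤ : φ ≼ ⊤'
  ≼-⊤ = prop (p ⇒ ⊤') (_ ∷ [])

  contrapose : φ ≼ ψ → ¬' ψ ≼ ¬' φ
  contrapose d = prop ((p ⇒ q) ⇒ ¬' q ⇒ ¬' p) (_ ∷ _ ∷ []) · d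

  dn-intro : φ ≼ ¬' ¬' φ
  dn-intro = prop (p ⇒ ¬' ¬' p) (_ ∷ [])

  □-mono : φ ≼ ψ → [ α ] φ ≼ [ α ] ψ
  □-mono d = axK · nec d

  □-mono₂ : φ ≼ ψ ⇒ χ → [ α ] φ ≼ [ α ] ψ ⇒ [ α ] χ
  □-mono₂ d = □-mono d ⨾ axK

  ◇-mono : φ ≼ ψ → ⟨ α ⟩ φ ≼ ⟨ α ⟩ ψ
  ◇-mono d = contrapose (□-mono (contrapose d))

  ◇-cong : φ ≈ ψ → ⟨ α ⟩ φ ≈ ⟨ α ⟩ ψ
  ◇-cong (d , e) = ◇-mono d , ◇-mono e

  ◇-empty : ⊢ (¬' φ) → ⊢ (¬' ⟨ α ⟩ φ)
  ◇-empty d = dn-intro · nec d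

  ◇-∧-□ : ⟨ α ⟩ φ ∧' [ α ] χ ≼ ⟨ α ⟩ (φ ∧' χ)
  ◇-∧-□ {φ = φ} {χ} =
    prop ((p ⇒ q ⇒ r) ⇒ (¬' r ∧' p ⇒ ¬' q)) (_ ∷ _ ∷ _ ∷ []) ·
    □-mono₂ (prop (p ⇒ ¬' (q ∧' p) ⇒ ¬' q) (χ ∷ φ ∷ []))

  ◇-∨ : ⟨ α ⟩ (φ ∨ ψ) ≼ ⟨ α ⟩ φ ∨ ⟨ α ⟩ ψ
  ◇-∨ {φ = φ} {ψ} =
    prop ((p ⇒ q ⇒ r) ⇒ (¬' r ⇒ ¬' p ∨ ¬' q)) (_ ∷ _ ∷ _ ∷ []) ·
    □-mono₂ (prop (¬' p ⇒ ¬' q ⇒ ¬' (p ∨ q)) (φ ∷ ψ ∷ []))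

  ◇-absorb : α ≤ β → ⟨ β ⟩ ⟨ α ⟩ φ ≼ ⟨ α ⟩ φ
  ◇-absorb l = contrapose (ax3 l ⨾ □-mono dn-intro)

  ◇-weaken : α ≤ β → ⟨ β ⟩ φ ≼ ⟨ α ⟩ φ
  ◇-weaken l = contrapose (ax5 l)

  -- Contrapositive of `axL` for `¬' φ`.
  ◇-löb : ⟨ α ⟩ φ ≼ ⟨ α ⟩ (φ ∧' ¬' ⟨ α ⟩ φ)
  ◇-löb {α} {φ} =
    contrapose (□-mono (prop (¬' (p ∧' ¬' ¬' q) ⇒ (q ⇒ ¬' p)) (φ ∷ [ α ] (¬' φ) ∷ [])) ⨾ axL)

  -- Formulas preserved by a modality

  Persistent : A → Fm A → Set
  Persistent β τ = τ ≼ [ β ] τ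

  ⊤-persistent : Persistent β ⊤'
  ⊤-persistent = prop (p ⇒ (q ⇒ p)) (_ ∷ _ ∷ []) · nec (taut λ _ → refl)

  ¬◇-persistent : α < β → Persistent β (¬' ⟨ α ⟩ φ)
  ¬◇-persistent l = prop (¬' ¬' p ⇒ p) (_ ∷ []) ⨾ ax3 (inj₁ l) ⨾ □-mono dn-intro

  ◇-∧-persistent : Persistent β τ → ⟨ β ⟩ φ ∧' τ ≼ ⟨ β ⟩ (φ ∧' τ)
  ◇-∧-persistent d = ∧-mono ≼-refl d ⨾ ◇-∧-□

  ite : ∀ {B : Set} → Fm B → Fm B → Fm B → Fm B
  ite φ ψ χ = (φ ⇒ ψ) ∧' (¬' φ ⇒ χ)

  ite-cong : ∀ {φ ψ ψ′ χ χ′} → ψ ≈ ψ′ → χ ≈ χ′ → ite φ ψ χ ≈ ite φ ψ′ χ′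
  ite-cong {φ} {ψ} {ψ′} {χ} {χ′} (d , d′) (e , e′) = mono d e , mono d′ e′
    where
    mono : ∀ {ψ ψ′ χ χ′} → ψ ≼ ψ′ → χ ≼ χ′ → ite φ ψ χ ≼ ite φ ψ′ χ′
    mono d e = prop ((p ⇒ q) ⇒ (r ⇒ s) ⇒ ite (var 4) p r ⇒ ite (var 4) q s)
                    (_ ∷ _ ∷ _ ∷ _ ∷ _ ∷ []) · d · e

  ≈-trans : ∀ {φ ψ χ} → φ ≈ ψ → ψ ≈ χ → φ ≈ χ
  ≈-trans (d , d′) (e , e′) = d ⨾ e , e′ ⨾ d′

  -- Both τ and its negation survive the step along α, so the case distinction may be made before
  -- it.
  ◇-ite-persistent : ∀ {τ χ φ ψ} → Persistent α τ → Persistent α (¬' τ) →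
    ite τ (⟨ α ⟩ (χ ∧' φ)) (⟨ α ⟩ (χ ∧' ψ)) ≈ ⟨ α ⟩ (χ ∧' ite τ φ ψ)
  ◇-ite-persistent {τ = τ} {χ} {φ} {ψ} d e =
    ( prop ((q ∧' p ⇒ s) ⇒ (r ∧' ¬' p ⇒ s) ⇒ ite p q r ⇒ s) (τ ∷ _ ∷ _ ∷ _ ∷ [])
        · (◇-∧-persistent d ⨾ ◇-mono (prop ((r ∧' q) ∧' p ⇒ r ∧' ite p q s) (τ ∷ φ ∷ χ ∷ ψ ∷ [])))
        · (◇-∧-persistent e ⨾ ◇-mono (prop ((r ∧' s) ∧' ¬' p ⇒ r ∧' ite p q s) (τ ∷ φ ∷ χ ∷ ψ ∷ [])))
    , prop ((s ∧' p ⇒ q) ⇒ (s ∧' ¬' p ⇒ r) ⇒ s ⇒ ite p q r) (τ ∷ _ ∷ _ ∷ _ ∷ [])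
        · (◇-∧-persistent d ⨾ ◇-mono (prop ((r ∧' ite p q s) ∧' p ⇒ r ∧' q) (τ ∷ φ ∷ χ ∷ ψ ∷ [])))
        · (◇-∧-persistent e ⨾ ◇-mono (prop ((r ∧' ite p q s) ∧' ¬' p ⇒ r ∧' s) (τ ∷ φ ∷ χ ∷ ψ ∷ []))))

  ◇-distrib-∨ : ∀ {φ ψ} → ⟨ α ⟩ φ ∨ ⟨ α ⟩ ψ ≈ ⟨ α ⟩ (φ ∨ ψ)
  ◇-distrib-∨ {φ = φ} {ψ} =
    ( prop ((p ⇒ r) ⇒ (q ⇒ r) ⇒ p ∨ q ⇒ r) (_ ∷ _ ∷ _ ∷ [])
        · ◇-mono (prop (p ⇒ p ∨ q) (φ ∷ ψ ∷ [])) · ◇-mono (prop (q ⇒ p ∨ q) (φ ∷ ψ ∷ []))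
    , ◇-∨)

  ∨-cong : ∀ {φ φ′ ψ ψ′} → φ ≈ φ′ → ψ ≈ ψ′ → φ ∨ ψ ≈ φ′ ∨ ψ′
  ∨-cong (d , d′) (e , e′) = mono d e , mono d′ e′
    where
    mono : ∀ {φ φ′ ψ ψ′} → φ ≼ φ′ → ψ ≼ ψ′ → φ ∨ ψ ≼ φ′ ∨ ψ′
    mono d e = prop ((p ⇒ q) ⇒ (r ⇒ s) ⇒ p ∨ r ⇒ q ∨ s) (_ ∷ _ ∷ _ ∷ _ ∷ []) · d · e

-- Worms and normal forms of closed formulas

module NormalForm {A : Set} {_<_ : A → A → Set} (sto : IsStrictTotalOrder _≡_ _<_) where
  open IsStrictTotalOrder sto using (compare) renaming (trans to <-trans)
  open GLP _<_
  open PropositionalReasoning _<_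
  open Modal _<_
  open Soundness (IsStrictTotalOrder._≟_ sto) using (Positive; ⊤⁺; _∧⁺_; ⟨_⟩⁺)
  open Consistency sto using (positive-consistent)

  Sorted : List A → Set
  Sorted = AllPairs _<_

  private variable
    α β γ : A
    S U : List A

  head-≤ : Sorted (γ ∷ S) → β ∈ γ ∷ S → γ ≤ β
  head-≤ _       (here refl) = inj₂ refl
  head-≤ (h ∷ _) (there i)   = inj₁ (All.lookup h i)

  -- In the usual notation A ▹ B is the word A γ B.
  data Worm : List A → Set where
    ε   : Worm []
    ⌊_⌋ : Worm S → Worm (γ ∷ S)
    _▹_ : Worm S → Worm (γ ∷ S) → Worm (γ ∷ S)

  -- For modalities of `A` above γ the word AγB is equivalent to A ∧ ⟨γ⟩B, which is taken as its
  -- reading.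
  ⌜_⌝ : Worm S → Fm A
  ⌜ ε ⌝             = ⊤'
  ⌜ ⌊ A ⌋ ⌝         = ⌜ A ⌝
  ⌜ _▹_ {γ = γ} A B ⌝ = ⌜ A ⌝ ∧' ⟨ γ ⟩ ⌜ B ⌝

  worm-positive : (A : Worm S) → Positive ⌜ A ⌝
  worm-positive ε       = ⊤⁺
  worm-positive ⌊ A ⌋   = worm-positive A
  worm-positive (A ▹ B) = worm-positive A ∧⁺ ⟨ _ ⟩⁺ (worm-positive B)

  ⊤ʷ : ∀ S → Worm S
  ⊤ʷ []      = ε
  ⊤ʷ (_ ∷ S) = ⌊ ⊤ʷ S ⌋

  ⊤ʷ-≡ : ∀ S → ⌜ ⊤ʷ S ⌝ ≡ ⊤'
  ⊤ʷ-≡ []      = refl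
  ⊤ʷ-≡ (_ ∷ S) = ⊤ʷ-≡ S

  -- Comparison and conjunction of worms

  head : Worm (γ ∷ S) → Worm S
  head ⌊ A ⌋   = A
  head (A ▹ _) = A

  tail : Worm (γ ∷ S) → Fm A
  tail ⌊ _ ⌋           = ⊤'
  tail {γ = γ} (_ ▹ B) = ⟨ γ ⟩ ⌜ B ⌝

  head∧tail : (A : Worm (γ ∷ S)) → ⌜ A ⌝ ≈ ⌜ head A ⌝ ∧' tail A
  head∧tail ⌊ A ⌋   = ≼-∧ ≼-refl ≼-⊤ , ∧-≼ˡ
  head∧tail (A ▹ B) = ≼-refl , ≼-refl

  tail-persistent : (A : Worm (γ ∷ S)) → γ < β → Persistent β (tail A)
  tail-persistent ⌊ _ ⌋   _ = ⊤-persistent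
  tail-persistent (_ ▹ _) l = ax4 l

  -- Any β from `S` may witness a strict comparison, so over the empty list only `eq` remains. A β
  -- obtained from heads lies above γ, as `head-lt` requires.
  data Cmp (A B : Worm S) : Set where
    lt : β ∈ S → ⌜ B ⌝ ≼ ⟨ β ⟩ ⌜ A ⌝ → Cmp A B
    eq : ⌜ A ⌝ ≈ ⌜ B ⌝ → Cmp A B
    gt : β ∈ S → ⌜ A ⌝ ≼ ⟨ β ⟩ ⌜ B ⌝ → Cmp A B

  flip : {A B : Worm S} → Cmp A B → Cmp B A
  flip (lt i d)       = gt i d
  flip (eq (d , e))   = eq (e , d)
  flip (gt i d)       = lt i d

  ◇-least : {A B : Worm (γ ∷ S)} → Sorted (γ ∷ S) → Cmp A B →
            (⟨ γ ⟩ ⌜ B ⌝ ≼ ⟨ γ ⟩ ⌜ A ⌝) ⊎ (⌜ A ⌝ ≼ ⟨ γ ⟩ ⌜ B ⌝)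
  ◇-least o (lt i d)       = inj₁ (◇-mono d ⨾ ◇-mono (◇-weaken (head-≤ o i)) ⨾ ◇-absorb (inj₂ refl))
  ◇-least o (eq (_ , d))   = inj₁ (◇-mono d)
  ◇-least o (gt i d)       = inj₂ (d ⨾ ◇-weaken (head-≤ o i))

  -- The tail of `A` is persistent under β, since γ < β, and so joins the head inside ⟨β⟩.
  head-lt : (A B : Worm (γ ∷ S)) → γ < β → ⌜ B ⌝ ≼ tail A →
            ⌜ head B ⌝ ≼ ⟨ β ⟩ ⌜ head A ⌝ → ⌜ B ⌝ ≼ ⟨ β ⟩ ⌜ A ⌝
  head-lt A B l e d =
    ≼-∧ (proj₁ (head∧tail B) ⨾ ∧-≼ˡ ⨾ d) e ⨾
    ◇-∧-persistent (tail-persistent A l) ⨾ ◇-mono (proj₂ (head∧tail A))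

  cmp-heads : {A B : Worm (γ ∷ S)} → Sorted (γ ∷ S) → ⌜ A ⌝ ≼ tail B → ⌜ B ⌝ ≼ tail A →
              Cmp (head A) (head B) → Cmp A B
  cmp-heads {A = A} {B} (h ∷ _) d e (lt i c) = lt (there i) (head-lt A B (All.lookup h i) e c)
  cmp-heads {A = A} {B} o d e (eq (c , c′)) = eq
    ( ≼-∧ (proj₁ (head∧tail A) ⨾ ∧-≼ˡ ⨾ c) d ⨾ proj₂ (head∧tail B)
    , ≼-∧ (proj₁ (head∧tail B) ⨾ ∧-≼ˡ ⨾ c′) e ⨾ proj₂ (head∧tail A))
  cmp-heads {A = A} {B} (h ∷ _) d e (gt i c) = gt (there i) (head-lt B A (All.lookup h i) d c)

  -- If B's tail ⟨γ⟩B′ satisfies ⟨γ⟩B′ ≼ ⟨γ⟩A then A lies below B; otherwise A ≼ ⟨γ⟩B′.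
  -- When both worms imply each other's tail, the heads decide.
  cmp : Sorted S → (A B : Worm S) → Cmp A B
  cmp o ε ε = eq (≼-refl , ≼-refl)
  cmp o@(_ ∷ o′) ⌊ A ⌋ ⌊ B ⌋ = cmp-heads o ≼-⊤ ≼-⊤ (cmp o′ A B)
  cmp o@(_ ∷ o′) ⌊ A ⌋ (B ▹ B′) with ◇-least o (cmp o ⌊ A ⌋ B′)
  ... | inj₁ d = lt (here refl) (∧-≼ʳ ⨾ d)
  ... | inj₂ d = cmp-heads o d ≼-⊤ (cmp o′ A B)
  cmp o@(_ ∷ o′) (A ▹ A′) ⌊ B ⌋ with ◇-least o (flip (cmp o A′ ⌊ B ⌋))
  ... | inj₁ e = gt (here refl) (∧-≼ʳ ⨾ e)
  ... | inj₂ e = cmp-heads o ≼-⊤ e (cmp o′ A B)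
  cmp o@(_ ∷ o′) (A ▹ A′) (B ▹ B′)
    with ◇-least o (cmp o (A ▹ A′) B′) | ◇-least o (flip (cmp o A′ (B ▹ B′)))
  ... | inj₁ d | _      = lt (here refl) (∧-≼ʳ ⨾ d)
  ... | inj₂ _ | inj₁ e = gt (here refl) (∧-≼ʳ ⨾ e)
  ... | inj₂ d | inj₂ e = cmp-heads o d e (cmp o′ A B)

  -- By `◇-least` one of the two diamonds implies the other, so the stronger one is the conjunction.
  ◇-max : Sorted (γ ∷ S) → (A B : Worm (γ ∷ S)) →
          Σ (Worm (γ ∷ S)) λ C → ⟨ γ ⟩ ⌜ C ⌝ ≈ ⟨ γ ⟩ ⌜ A ⌝ ∧' ⟨ γ ⟩ ⌜ B ⌝
  ◇-max o A B with ◇-least o (cmp o A B)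
  ... | inj₁ d = B , ≼-∧ d ≼-refl , ∧-≼ʳ
  ... | inj₂ d = A , ≼-∧ ≼-refl (◇-mono d ⨾ ◇-absorb (inj₂ refl)) , ∧-≼ˡ

  conj : Sorted S → (A B : Worm S) → Σ (Worm S) λ C → ⌜ C ⌝ ≈ ⌜ A ⌝ ∧' ⌜ B ⌝
  conj o ε ε = ε , ≼-∧ ≼-refl ≼-refl , ∧-≼ˡ
  conj (_ ∷ o) ⌊ A ⌋ ⌊ B ⌋ = let C , d = conj o A B in ⌊ C ⌋ , d
  conj (_ ∷ o) ⌊ A ⌋ (B ▹ B′) =
    let C , d , e = conj o A B in
    C ▹ B′ ,
    ∧-mono d ≼-refl ⨾ prop ((p ∧' q) ∧' r ⇒ p ∧' (q ∧' r)) (_ ∷ _ ∷ _ ∷ []) ,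
    prop (p ∧' (q ∧' r) ⇒ (p ∧' q) ∧' r) (_ ∷ _ ∷ _ ∷ []) ⨾ ∧-mono e ≼-refl
  conj (_ ∷ o) (A ▹ A′) ⌊ B ⌋ =
    let C , d , e = conj o A B in
    C ▹ A′ ,
    ∧-mono d ≼-refl ⨾ prop ((p ∧' q) ∧' r ⇒ (p ∧' r) ∧' q) (_ ∷ _ ∷ _ ∷ []) ,
    prop ((p ∧' r) ∧' q ⇒ (p ∧' q) ∧' r) (_ ∷ _ ∷ _ ∷ []) ⨾ ∧-mono e ≼-refl
  conj o@(_ ∷ o′) (A ▹ A′) (B ▹ B′) =
    let C  , d  , e  = conj o′ A B
        C′ , d′ , e′ = ◇-max o A′ B′ in
    C ▹ C′ ,
    ∧-mono d d′ ⨾ prop ((p ∧' q) ∧' (r ∧' s) ⇒ (p ∧' r) ∧' (q ∧' s)) (_ ∷ _ ∷ _ ∷ _ ∷ []) ,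
    prop ((p ∧' r) ∧' (q ∧' s) ⇒ (p ∧' q) ∧' (r ∧' s)) (_ ∷ _ ∷ _ ∷ _ ∷ []) ⨾ ∧-mono e e′

  -- Compare `A` with the worm `C` of A ∧ B. Equivalence gives A → B, and `C` above `A` gives ⟨γ⟩A.
  -- If `C` is below `A`, then `A` yields ⟨γ⟩C and hence ⟨γ⟩A.
  implies? : Sorted (γ ∷ S) → (A B : Worm (γ ∷ S)) →
             (⌜ A ⌝ ≼ ⌜ B ⌝) ⊎ (⌜ A ⌝ ∧' ⌜ B ⌝ ≼ ⟨ γ ⟩ ⌜ A ⌝)
  implies? o A B with conj o A B
  ... | C , d , e with cmp o C A
  ...   | lt i c       = inj₂ (∧-≼ˡ ⨾ c ⨾ ◇-mono (d ⨾ ∧-≼ˡ) ⨾ ◇-weaken (head-≤ o i))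
  ...   | eq (_ , c)   = inj₁ (c ⨾ d ⨾ ∧-≼ʳ)
  ...   | gt i c       = inj₂ (e ⨾ c ⨾ ◇-weaken (head-≤ o i))

  -- Clauses: one worm with finitely many worms negated

  nor : List (Worm S) → Fm A
  nor []       = ⊤'
  nor (C ∷ Cs) = ¬' ⌜ C ⌝ ∧' nor Cs

  _∖_ : Worm S → List (Worm S) → Fm A
  B ∖ Cs = ⌜ B ⌝ ∧' nor Cs

  -- If `B` implies a member of `Cs`, the clause is refutable. Otherwise B ∧ C → ⟨γ⟩B for each
  -- member `C`, so `C` fails where `B` holds without ⟨γ⟩B; `◇-löb` supplies such a point in
  -- `clause?`.
  refute? : Sorted (γ ∷ S) → (B : Worm (γ ∷ S)) (Cs : List (Worm (γ ∷ S))) →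
            (⊢ (¬' (B ∖ Cs))) ⊎ (⌜ B ⌝ ∧' ¬' ⟨ γ ⟩ ⌜ B ⌝ ≼ nor Cs)
  refute? o B [] = inj₂ ≼-⊤
  refute? o B (C ∷ Cs) with implies? o B C | refute? o B Cs
  ... | inj₁ d | _      = inj₁ (prop ((p ⇒ q) ⇒ ¬' (p ∧' (¬' q ∧' r))) (_ ∷ _ ∷ _ ∷ []) · d)
  ... | inj₂ _ | inj₁ e = inj₁ (prop (¬' (p ∧' r) ⇒ ¬' (p ∧' (q ∧' r))) (_ ∷ _ ∷ _ ∷ []) · e)
  ... | inj₂ d | inj₂ e =
    inj₂ (≼-∧ (prop ((p ∧' q ⇒ r) ⇒ (p ∧' ¬' r ⇒ ¬' q)) (_ ∷ _ ∷ _ ∷ []) · d) e)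

  clause? : Sorted (γ ∷ S) → (B : Worm (γ ∷ S)) (Cs : List (Worm (γ ∷ S))) →
            (⊢ (¬' (B ∖ Cs))) ⊎ (⟨ γ ⟩ ⌜ B ⌝ ≼ ⟨ γ ⟩ (B ∖ Cs))
  clause? o B Cs with refute? o B Cs
  ... | inj₁ d = inj₁ d
  ... | inj₂ d = inj₂ (◇-löb ⨾ ◇-mono (≼-∧ ∧-≼ˡ d))

  -- For sorted `S`, a `Suffix (γ ∷ U) S` selects γ together with the list `U` of all modalities of
  -- `S` above it.
  data Suffix (U : List A) : List A → Set where
    done : Suffix U U
    drop : Suffix U S → Suffix U (γ ∷ S)

  suffix-sorted : Suffix U S → Sorted S → Sorted U
  suffix-sorted done     o       = o
  suffix-sorted (drop i) (_ ∷ o) = suffix-sorted i o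

  suffix-∈ : Suffix (α ∷ U) S → α ∈ S
  suffix-∈ done     = here refl
  suffix-∈ (drop i) = there (suffix-∈ i)

  ∈-suffix : α ∈ S → ∃ λ U → Suffix (α ∷ U) S
  ∈-suffix (here refl) = _ , done
  ∈-suffix (there i)   = let U , j = ∈-suffix i in U , drop j

  data Atom (S : List A) : Set where
    at : Suffix (γ ∷ U) S → Worm (γ ∷ U) → Atom S

  ⌜_⌝ᵃ : Atom S → Fm A
  ⌜ at {γ = γ} _ A ⌝ᵃ = ⟨ γ ⟩ ⌜ A ⌝

  atom-worm : (i : Suffix (γ ∷ U) S) (A : Worm (γ ∷ U)) →
              Σ (Worm S) λ B → ⌜ B ⌝ ≈ ⟨ γ ⟩ ⌜ A ⌝
  atom-worm {U = U} done A = ⊤ʷ U ▹ A , ∧-≼ʳ ,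
    ≼-∧ (subst (⟨ _ ⟩ ⌜ A ⌝ ≼_) (sym (⊤ʷ-≡ U)) ≼-⊤) ≼-refl
  atom-worm (drop i) A = let B , d = atom-worm i A in ⌊ B ⌋ , d

  -- An atom with modality below α can be pulled out of ⟨α⟩, by axioms (iii) and (iv); any other is
  -- a worm over modalities ≥ α and can enter a clause.
  classify : Sorted S → Suffix (α ∷ U) S → (a : Atom S) →
             (Persistent α ⌜ a ⌝ᵃ × Persistent α (¬' ⌜ a ⌝ᵃ))
             ⊎ (Σ (Worm (α ∷ U)) λ B → ⌜ B ⌝ ≈ ⌜ a ⌝ᵃ)
  classify o       done     (at j A)        = inj₂ (atom-worm j A)
  classify (h ∷ _) (drop i) (at done A)     =
    let l = All.lookup h (suffix-∈ i) in inj₁ (ax4 l , ¬◇-persistent l)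
  classify (_ ∷ o) (drop i) (at (drop j) A) = classify o i (at j A)

  -- Decision trees over atoms

  data Tree (S : List A) : Set where
    leaf : Bool → Tree S
    node : Atom S → Tree S → Tree S → Tree S

  ⌜_⌝ᵗ : Tree S → Fm A
  ⌜ leaf true ⌝ᵗ  = ⊤'
  ⌜ leaf false ⌝ᵗ = ¬' ⊤'
  ⌜ node a l r ⌝ᵗ = ite ⌜ a ⌝ᵃ ⌜ l ⌝ᵗ ⌜ r ⌝ᵗ

  neg : (t : Tree S) → Σ (Tree S) λ u → ⌜ u ⌝ᵗ ≈ ¬' ⌜ t ⌝ᵗ
  neg (leaf true)  = leaf false , ≼-refl , ≼-refl
  neg (leaf false) = leaf true , dn-intro , ≼-⊤
  neg (node a t₁ t₂) =
    let t₁′ , d = neg t₁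
        t₂′ , e = neg t₂ in
    node a t₁′ t₂′ , ≈-trans (ite-cong d e)
      ( prop (ite p (¬' q) (¬' r) ⇒ ¬' ite p q r) (_ ∷ _ ∷ _ ∷ [])
      , prop (¬' ite p q r ⇒ ite p (¬' q) (¬' r)) (_ ∷ _ ∷ _ ∷ []))

  and : (t u : Tree S) → Σ (Tree S) λ v → ⌜ v ⌝ᵗ ≈ ⌜ t ⌝ᵗ ∧' ⌜ u ⌝ᵗ
  and (leaf true)  u = u , ≼-∧ ≼-⊤ ≼-refl , ∧-≼ʳ
  and (leaf false) u = leaf false , prop (¬' ⊤' ⇒ ¬' ⊤' ∧' p) (_ ∷ []) , ∧-≼ˡ
  and (node a t₁ t₂) u =
    let t₁′ , d = and t₁ u
        t₂′ , e = and t₂ u in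
    node a t₁′ t₂′ , ≈-trans (ite-cong d e)
      ( prop (ite p (q ∧' s) (r ∧' s) ⇒ ite p q r ∧' s) (_ ∷ _ ∷ _ ∷ _ ∷ [])
      , prop (ite p q r ∧' s ⇒ ite p (q ∧' s) (r ∧' s)) (_ ∷ _ ∷ _ ∷ _ ∷ []))

  or : (t u : Tree S) → Σ (Tree S) λ v → ⌜ v ⌝ᵗ ≈ ⌜ t ⌝ᵗ ∨ ⌜ u ⌝ᵗ
  or (leaf true)  u = leaf true , prop (⊤' ⇒ ⊤' ∨ p) (_ ∷ []) , ≼-⊤
  or (leaf false) u = u , prop (p ⇒ ¬' ⊤' ∨ p) (_ ∷ []) , prop (¬' ⊤' ∨ p ⇒ p) (_ ∷ [])
  or (node a t₁ t₂) u =
    let t₁′ , d = or t₁ u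
        t₂′ , e = or t₂ u in
    node a t₁′ t₂′ , ≈-trans (ite-cong d e)
      ( prop (ite p (q ∨ s) (r ∨ s) ⇒ ite p q r ∨ s) (_ ∷ _ ∷ _ ∷ _ ∷ [])
      , prop (ite p q r ∨ s ⇒ ite p (q ∨ s) (r ∨ s)) (_ ∷ _ ∷ _ ∷ _ ∷ []))

  -- Case distinction on an atom that is a worm `C`: where true it merges into `B`, where false it
  -- joins `Cs`.
  split-node : (B B⁺ C : Worm S) (Cs : List (Worm S)) (a : Atom U) (t₁ t₂ : Tree U) →
    ⌜ C ⌝ ≈ ⌜ a ⌝ᵃ → ⌜ B⁺ ⌝ ≈ ⌜ B ⌝ ∧' ⌜ C ⌝ →
    ((B⁺ ∖ Cs) ∧' ⌜ t₁ ⌝ᵗ) ∨ ((B ∖ (C ∷ Cs)) ∧' ⌜ t₂ ⌝ᵗ) ≈ (B ∖ Cs) ∧' ⌜ node a t₁ t₂ ⌝ᵗ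
  split-node W W⁺ D Ds d t₁ t₂ (c , c′) (b , b′) =
    ( prop ((C ⇒ a) ⇒ (a ⇒ C) ⇒ (B⁺ ⇒ B ∧' C) ⇒ (B ∧' C ⇒ B⁺) ⇒ lhs ⇒ rhs) σ · c · c′ · b · b′
    , prop ((C ⇒ a) ⇒ (a ⇒ C) ⇒ (B⁺ ⇒ B ∧' C) ⇒ (B ∧' C ⇒ B⁺) ⇒ rhs ⇒ lhs) σ · c · c′ · b · b′)
    where
    σ = ⌜ W ⌝ ∷ ⌜ W⁺ ⌝ ∷ ⌜ D ⌝ ∷ nor Ds ∷ ⌜ d ⌝ᵃ ∷ ⌜ t₁ ⌝ᵗ ∷ ⌜ t₂ ⌝ᵗ ∷ []
    B = var 0
    B⁺ = var 1
    C = var 2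
    N = var 3
    a = var 4
    lhs = (B⁺ ∧' N) ∧' var 5 ∨ (B ∧' (¬' C ∧' N)) ∧' var 6
    rhs = (B ∧' N) ∧' ite a (var 5) (var 6)

  -- `B` and `Cs` collect the worm literals along a branch, while persistent atoms stay outside ⟨α⟩
  -- as nodes of the result. At a true leaf `clause?` leaves ⟨α⟩B or falsity.
  ◇-tree : Sorted S → (i : Suffix (α ∷ U) S) (B : Worm (α ∷ U)) (Cs : List (Worm (α ∷ U)))
           (t : Tree S) → Σ (Tree S) λ u → ⌜ u ⌝ᵗ ≈ ⟨ α ⟩ ((B ∖ Cs) ∧' ⌜ t ⌝ᵗ)
  ◇-tree o i B Cs (leaf false) = leaf false ,
    prop (¬' ⊤' ⇒ p) (_ ∷ []) ,
    prop (¬' p ⇒ p ⇒ ¬' ⊤') (_ ∷ []) · ◇-empty (prop (¬' (p ∧' ¬' ⊤')) (_ ∷ []))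
  ◇-tree o i B Cs (leaf true) with clause? (suffix-sorted i o) B Cs
  ... | inj₁ d = leaf false ,
    prop (¬' ⊤' ⇒ p) (_ ∷ []) ,
    prop (¬' p ⇒ p ⇒ ¬' ⊤') (_ ∷ []) · ◇-empty (prop (¬' p ⇒ ¬' (p ∧' ⊤')) (_ ∷ []) · d)
  ... | inj₂ d = node (at i B) (leaf true) (leaf false) , ≈-trans
    ( prop (ite p ⊤' (¬' ⊤') ⇒ p) (_ ∷ []) , prop (p ⇒ ite p ⊤' (¬' ⊤')) (_ ∷ []))
    ( d ⨾ ◇-mono (≼-∧ ≼-refl ≼-⊤) , ◇-mono (∧-≼ˡ ⨾ ∧-≼ˡ))
  ◇-tree o i B Cs (node a t₁ t₂) with classify o i a
  ... | inj₁ (d , e) =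
    let t₁′ , f = ◇-tree o i B Cs t₁
        t₂′ , g = ◇-tree o i B Cs t₂ in
    node a t₁′ t₂′ , ≈-trans (ite-cong f g) (◇-ite-persistent d e)
  ... | inj₂ (C , c) =
    let B⁺ , b = conj (suffix-sorted i o) B C
        t₁′ , f = ◇-tree o i B⁺ Cs t₁
        t₂′ , g = ◇-tree o i B (C ∷ Cs) t₂
        u , h = or t₁′ t₂′ in
    u , ≈-trans h (≈-trans (∨-cong f g) (≈-trans ◇-distrib-∨ (◇-cong (split-node B B⁺ C Cs a t₁ t₂ c b))))

  -- Normalisation and the decision procedure

  modalities : CFm A → List A
  modalities ⊤c          = []
  modalities (¬c φ)      = modalities φ
  modalities (φ ∧c ψ)    = modalities φ ++ modalities ψ
  modalities ([ α ]c φ)  = α ∷ modalities φ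

  normalise : Sorted S → (φ : CFm A) → (∀ {α} → α ∈ modalities φ → α ∈ S) →
              Σ (Tree S) λ t → ⌜ t ⌝ᵗ ≈ embed φ
  normalise o ⊤c _ = leaf true , ≼-refl , ≼-refl
  normalise o (¬c φ) m =
    let t , d , d′ = normalise o φ m
        u , e = neg t in
    u , ≈-trans e (contrapose d′ , contrapose d)
  normalise o (φ ∧c ψ) m =
    let t , d , d′ = normalise o φ (m ∘ ∈-++⁺ˡ)
        u , e , e′ = normalise o ψ (m ∘ ∈-++⁺ʳ (modalities φ))
        v , f = and t u in
    v , ≈-trans f (∧-mono d e , ∧-mono d′ e′)
  normalise o ([ α ]c φ) m =
    let t , d , d′ = normalise o φ (m ∘ there)
        U , i = ∈-suffix (m (here refl))
        u , e , e′ = neg t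
        -- The box is treated as ¬⟨α⟩¬φ, starting from the trivial clause.
        v , f = ◇-tree o i (⊤ʷ (α ∷ U)) [] u
        w , g = neg v in
    w , ≈-trans g (≈-trans (contrapose (proj₂ f) , contrapose (proj₁ f))
      ( prop (¬' ¬' p ⇒ p) (_ ∷ []) ⨾ □-mono (drop-⊤ U d e′)
      , □-mono (add-⊤ U d′ e) ⨾ dn-intro))
    where
    drop-⊤ : ∀ U {φ ψ χ} → ψ ≼ φ → ¬' ψ ≼ χ → ¬' ((⊤ʷ U ∖ []) ∧' χ) ≼ φ
    drop-⊤ U {φ} {ψ} {χ} d e = subst (λ τ → ¬' ((τ ∧' ⊤') ∧' χ) ≼ φ) (sym (⊤ʷ-≡ U))
      (prop ((q ⇒ p) ⇒ (¬' q ⇒ r) ⇒ ¬' ((⊤' ∧' ⊤') ∧' r) ⇒ p) (φ ∷ ψ ∷ χ ∷ []) · d · e)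
    add-⊤ : ∀ U {φ ψ χ} → φ ≼ ψ → χ ≼ ¬' ψ → φ ≼ ¬' ((⊤ʷ U ∖ []) ∧' χ)
    add-⊤ U {φ} {ψ} {χ} d e =
      prop ((p ⇒ q) ⇒ (r ⇒ ¬' q) ⇒ p ⇒ ¬' (s ∧' r)) (φ ∷ ψ ∷ χ ∷ _ ∷ []) · d · e

  -- Evidence against refutability: refuting φ would refute ⟨γ⟩φ and hence ⟨γ⟩D, contrary to the
  -- consistency of worms.
  Satisfied : A → List A → Fm A → Set
  Satisfied γ S φ = Σ (Worm (γ ∷ S)) λ D → ⟨ γ ⟩ ⌜ D ⌝ ≼ ⟨ γ ⟩ φ

  ∨-satisfied? : ∀ {φ ψ χ} → φ ∨ ψ ≈ χ → (⊢ (¬' φ)) ⊎ Satisfied γ S φ →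
                 (⊢ (¬' ψ)) ⊎ Satisfied γ S ψ → (⊢ (¬' χ)) ⊎ Satisfied γ S χ
  ∨-satisfied? (_ , e) (inj₁ f) (inj₁ g) =
    inj₁ (prop ((r ⇒ p ∨ q) ⇒ ¬' p ⇒ ¬' q ⇒ ¬' r) (_ ∷ _ ∷ _ ∷ []) · e · f · g)
  ∨-satisfied? (d , _) (inj₂ (D , f)) _ =
    inj₂ (D , f ⨾ ◇-mono (prop (p ⇒ p ∨ q) (_ ∷ _ ∷ []) ⨾ d))
  ∨-satisfied? (d , _) (inj₁ _) (inj₂ (D , g)) =
    inj₂ (D , g ⨾ ◇-mono (prop (q ⇒ p ∨ q) (_ ∷ _ ∷ []) ⨾ d))

  -- γ is least here, so every atom is a worm over γ ∷ S and none has to be pulled out.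
  satisfy? : Sorted (γ ∷ S) → (B : Worm (γ ∷ S)) (Cs : List (Worm (γ ∷ S))) (t : Tree (γ ∷ S)) →
    (⊢ (¬' ((B ∖ Cs) ∧' ⌜ t ⌝ᵗ))) ⊎ Satisfied γ S ((B ∖ Cs) ∧' ⌜ t ⌝ᵗ)
  satisfy? o B Cs (leaf false) = inj₁ (prop (¬' (p ∧' ¬' ⊤')) (_ ∷ []))
  satisfy? o B Cs (leaf true) with clause? o B Cs
  ... | inj₁ d = inj₁ (prop (¬' p ⇒ ¬' (p ∧' ⊤')) (_ ∷ []) · d)
  ... | inj₂ d = inj₂ (B , d ⨾ ◇-mono (≼-∧ ≼-refl ≼-⊤))
  satisfy? o B Cs (node (at j A) t₁ t₂) =
    let C , c = atom-worm j A
        B⁺ , b = conj o B C in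
    ∨-satisfied? (split-node B B⁺ C Cs (at j A) t₁ t₂ c b)
      (satisfy? o B⁺ Cs t₁) (satisfy? o B (C ∷ Cs) t₂)

  ◇-worm-consistent : (B : Worm S) → ¬ ⊢ (¬' ⟨ α ⟩ ⌜ B ⌝)
  ◇-worm-consistent B = positive-consistent (⟨ _ ⟩⁺ (worm-positive B))

  refutable? : Sorted S → (t : Tree S) → Dec (⊢ (¬' ⌜ t ⌝ᵗ))
  refutable? {[]} o (leaf false) = yes (dn-intro · taut λ _ → refl)
  refutable? {[]} o (leaf true)  = no (positive-consistent ⊤⁺)
  refutable? {[]} o (node (at () _) _ _)
  refutable? {γ ∷ S} o t with satisfy? o (⊤ʷ (γ ∷ S)) [] t
  ... | inj₂ (D , d) = no λ e → ◇-worm-consistent D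
    (contrapose d · ◇-empty (prop (¬' p ⇒ ¬' (q ∧' p)) (_ ∷ _ ∷ []) · e))
  ... | inj₁ d = yes (subst (λ τ → ⊢ (¬' ((τ ∧' ⊤') ∧' ⌜ t ⌝ᵗ)) → ⊢ (¬' ⌜ t ⌝ᵗ)) (sym (⊤ʷ-≡ S))
    (prop (¬' ((⊤' ∧' ⊤') ∧' p) ⇒ ¬' p) (_ ∷ []) ·_) d)

  -- The last component carries lower bounds through the recursion: a head passed over must stay
  -- below the enlarged tail.
  insert : ∀ α → Sorted S →
    Σ (List A) λ U → Sorted U × α ∈ U × (∀ {β} → β ∈ S → β ∈ U) ×
                     (∀ {β} → β < α → All (β <_) S → All (β <_) U)
  insert α [] = α ∷ [] , [] ∷ [] , here refl , (λ ()) , λ l _ → l ∷ []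
  insert α (_∷_ {γ} {S} h o) with compare α γ
  ... | tri< l _ _ = α ∷ γ ∷ S , (l ∷ All.map (<-trans l) h) ∷ h ∷ o , here refl , there , _∷_
  ... | tri≈ _ refl _ = γ ∷ S , h ∷ o , here refl , id , λ _ → id
  ... | tri> _ _ g =
    let U , o′ , i , sub , bound = insert α o in
    γ ∷ U , bound g h ∷ o′ , there i ,
    (λ { (here e) → here e ; (there j) → there (sub j) }) ,
    λ { l (k ∷ ks) → k ∷ bound l ks }

  sort : (Γ : List A) → Σ (List A) λ S → Sorted S × (∀ {α} → α ∈ Γ → α ∈ S)
  sort [] = [] , [] , λ ()
  sort (α ∷ Γ) =
    let S , o , m = sort Γ
        U , o′ , i , sub , _ = insert α o in
    U , o′ , λ { (here refl) → i ; (there j) → sub (m j) }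

  decide : (φ : CFm A) → Dec (GLP⁰⊢ φ)
  decide φ with sort (modalities φ)
  ... | S , o , m with normalise o (¬c φ) m
  ...   | t , d , d′ with refutable? o t
  ...     | yes e = yes (prop ((¬' p ⇒ q) ⇒ ¬' q ⇒ p) (_ ∷ _ ∷ []) · d′ · e)
  ...     | no ¬e = no λ e → ¬e (prop ((q ⇒ ¬' p) ⇒ p ⇒ ¬' q) (_ ∷ _ ∷ []) · d · e)

mainTheorem3 : (A : Set) (_<_ : A → A → Set) →
    IsStrictTotalOrder _≡_ _<_ →
    (φ : CFm A) → Dec (GLP.GLP⁰⊢_ _<_ φ)
mainTheorem3 A _<_ sto = NormalForm.decide sto
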